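{- For all positive integers $n,p$ with $p\le n^2$, $\Omega(\texttt{RP}(n,p))\le\texttt{PO}(n,p)\le O(\texttt{RP}(n,p)\log n)$.
   Context: For a directed graph $G=(V,E)$ and demand pairs $P\subseteq V\times V$, a reachability preserver is a subgraph $H\subseteq G$ such that for every $(s,t)\in P$ for which $G$ has an $s\leadsto t$ path, $H$ also has an $s\leadsto t$ path; $\texttt{RP}(n,p)$ is the smallest integer such that every $n$-node directed graph and every set of $p$ demand pairs has a reachability preserver with at most $\texttt{RP}(n,p)$ edges. A path oracle for $G,P$ is a data structure that, when queried with $(s,t)\in P$, reports an $s\leadsto t$ path in $G$ (or "no path" if none exists). $\texttt{PO}(n,p)$ is the smallest integer such that every $n$-node directed graph and every set of $|P|=p$ demand pairs has a path oracle of at most $\texttt{PO}(n,p)$ bits. -}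

module Defs where

open import Data.Nat using (ℕ; zero; suc; _+_; _*_; _≤_)
open import Data.Bool using (Bool; true; false; if_then_else_)
open import Data.Fin using (Fin)
open import Data.List using (List; []; _∷_; length; map; allFin)
open import Data.Nat.ListAction using (sum)
open import Data.List.Relation.Unary.Unique.Propositional using (Unique)
open import Data.List.Membership.Propositional using (_∈_)
open import Data.Maybe using (Maybe; just; nothing)
open import Data.Product using (_×_; _,_; Σ; ∃)
open import Relation.Nullary using (¬_)
open import Relation.Binary.PropositionalEquality using (_≡_)
open import Relation.Binary.Construct.Closure.ReflexiveTransitive using (Star)

Graph : ℕ → Set
Graph n = Fin n → Fin n → Bool

Edge : ∀ {n} → Graph n → Fin n → Fin n → Set
Edge G u v = G u v ≡ true

edgeCount : ∀ {n} → Graph n → ℕ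
edgeCount {n} G =
  sum (map (λ u → sum (map (λ v → if G u v then 1 else 0) (allFin n))) (allFin n))

_⊆G_ : ∀ {n} → Graph n → Graph n → Set
_⊆G_ {n} H G = (u v : Fin n) → Edge H u v → Edge G u v

Reach : ∀ {n} → Graph n → Fin n → Fin n → Set
Reach G s t = Star (Edge G) s t

DemandPairs : ℕ → ℕ → Set
DemandPairs n p = Σ (List (Fin n × Fin n)) λ P → Unique P × length P ≡ p

pairsOf : ∀ {n p} → DemandPairs n p → List (Fin n × Fin n)
pairsOf (P , _) = P

IsReachPreserver : ∀ {n} → Graph n → List (Fin n × Fin n) → Graph n → Set
IsReachPreserver {n} G P H =
  H ⊆G G × ((s t : Fin n) → (s , t) ∈ P → Reach G s t → Reach H s t)

RPBound : ℕ → ℕ → ℕ → Set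
RPBound n p r = (G : Graph n) (P : DemandPairs n p) →
  ∃ λ H → IsReachPreserver G (pairsOf P) H × edgeCount H ≤ r

IsRP : ℕ → ℕ → ℕ → Set
IsRP n p r = RPBound n p r × ((r' : ℕ) → RPBound n p r' → r ≤ r')

-- A path reported as the list of vertices after s (ending with t);
-- the empty list is the trivial path (s ≡ t).
IsPathList : ∀ {n} → Graph n → Fin n → List (Fin n) → Fin n → Set
IsPathList G s [] t = s ≡ t
IsPathList G s (v ∷ vs) t = Edge G s v × IsPathList G v vs t

CorrectAnswer : ∀ {n} → Graph n → Fin n → Fin n → Maybe (List (Fin n)) → Set
CorrectAnswer G s t (just vs) = IsPathList G s vs t
CorrectAnswer G s t nothing = ¬ Reach G s t

QueryAlg : ℕ → Set
QueryAlg n = List Bool → Fin n → Fin n → Maybe (List (Fin n))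

-- every n-node graph and every set of p demand pairs has a path oracle of
-- at most b bits: for each demand set P there is a fixed query algorithm
-- (independent of G) such that every graph G can be encoded by a bit string
-- of length ≤ b on which the algorithm answers all queries in P correctly.
POBound : ℕ → ℕ → ℕ → Set
POBound n p b = (P : DemandPairs n p) → Σ (QueryAlg n) λ Q →
  (G : Graph n) → ∃ λ (bits : List Bool) → length bits ≤ b ×
    ((s t : Fin n) → (s , t) ∈ pairsOf P → CorrectAnswer G s t (Q bits s t))

IsPO : ℕ → ℕ → ℕ → Set
IsPO n p b = POBound n p b × ((b' : ℕ) → POBound n p b' → b ≤ b')

{-# OPTIONS --safe #-}
module Submission where

-- Upper bound: store the edge list of a preserver H, two vertex codes of
-- ⌈log₂ n⌉ bits per edge, and answer queries by searching H.
--
-- Lower bound: prune G to a preserver H in which every edge e is critical, that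
-- is, deleting e disconnects some demand pair.  Colour the vertices with six
-- colours so that each class has at most n / 3 vertices; the edges of H split
-- into 36 classes according to the colours of their ends.  For one such class
-- es, each tail u gets one gadget vertex and each head v gets two, and a bit x(e)
-- for every e = (u , v) in es decides to which copy of v the edge leaves u.
-- Reachability in H ∖ es links heads back to tails.  A path in two gadgets at
-- once can never use an edge on whose bit they disagree, so it projects to a path
-- of H avoiding that edge; as the edge is critical, no oracle string can serve
-- both gadgets.  The 2 ^ |es| gadgets thus need different strings of length at
-- most b, which gives |es| ≤ b and edgeCount H ≤ 36 b.  For n < 3 it is enough to
-- separate H from H ∖ [ e ].

open import Defs
open import Data.Bool using (Bool; true; false; if_then_else_; not; _∧_)
import Data.Bool.Properties as Bool
open import Data.Empty using (⊥-elim)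
open import Data.Fin using (Fin; zero; suc; toℕ; fromℕ<; inject≤; combine; remQuot)
import Data.Fin.Properties as Fin
open import Data.List using (List; []; _∷_; [_]; _++_; length; map; filter; take; drop; concatMap; lookup; allFin; cartesianProduct)
import Data.List.Properties as List
open import Data.List.Membership.Propositional using (_∈_; _∉_; find; lose)
open import Data.List.Membership.Propositional.Properties
import Data.List.Membership.DecPropositional as DecMembership
open import Data.List.Relation.Binary.Subset.Propositional using (_⊆_)
open import Data.List.Relation.Unary.All as All using (All; []; _∷_)
import Data.List.Relation.Unary.All.Properties as All
open import Data.List.Relation.Unary.AllPairs as AllPairs using (AllPairs; []; _∷_)
import Data.List.Relation.Unary.AllPairs.Properties as AllPairs
open import Data.List.Relation.Unary.Any using (here; there)
open import Data.List.Relation.Unary.Unique.Propositional using (Unique)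
import Data.List.Relation.Unary.Unique.Propositional.Properties as Unique
import Data.List.Relation.Unary.Unique.DecPropositional.Properties as DecUnique
open import Data.Maybe using (Maybe; just; nothing)
open import Data.Nat using (ℕ; zero; suc; _+_; _*_; _∸_; _^_; _≤_; _<_; z≤n; s≤s; ⌊_/2⌋; ⌈_/2⌉; _≤?_; _<?_)
open import Data.Nat.DivMod using (_/_; _%_; m≡m%n+[m/n]*n; m%n<n)
open import Data.Nat.Induction using (<-wellFounded)
open import Data.Nat.ListAction using (sum)
open import Data.Nat.Logarithm using (⌈log₂_⌉)
open import Data.Nat.Logarithm.Core using (⌈log2⌉)
open import Data.Nat.Properties
open import Data.Product using (Σ; ∃; ∃₂; _×_; _,_; proj₁; proj₂)
open import Data.Product.Properties using (≡-dec)
open import Data.Sum using (_⊎_; inj₁; inj₂)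
open import Function using (_∘_)
open import Induction.WellFounded using (Acc; acc)
open import Relation.Binary using (DecidableEquality)
open import Relation.Binary.Construct.Closure.ReflexiveTransitive using (Star; ε; _◅_; _◅◅_; gmap; kleisliStar)
open import Relation.Binary.PropositionalEquality using (_≡_; _≢_; refl; sym; trans; cong; cong₂; subst; subst₂; module ≡-Reasoning)
open import Relation.Nullary using (¬_; Dec; yes; no; does; contradiction)
open import Relation.Nullary.Decidable using (_×-dec_; _⊎-dec_; _→-dec_; map′; dec-true; dec-false)
open import Relation.Unary using (Decidable)

private
  variable
    n : ℕ
    A B : Set

does-true : (a? : Dec A) → does a? ≡ true → A
does-true (yes a) _ = a

-- Lists without repetition

unique-⊆⇒length≤ : {xs ys : List A} → Unique xs → xs ⊆ ys → length xs ≤ length ys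
unique-⊆⇒length≤ {xs = []} [] _ = z≤n
unique-⊆⇒length≤ {xs = x ∷ xs} (x∉xs ∷ xs!) xs⊆ys with ∈-∃++ (xs⊆ys (here refl))
... | as , bs , refl = begin
  suc (length xs)              ≤⟨ s≤s (unique-⊆⇒length≤ xs! xs⊆as++bs) ⟩
  suc (length (as ++ bs))      ≡⟨ cong suc (List.length-++ as) ⟩
  suc (length as + length bs)  ≡⟨ +-suc (length as) (length bs) ⟨
  length as + suc (length bs)  ≡⟨ List.length-++ as ⟨
  length (as ++ x ∷ bs)        ∎
  where
  open ≤-Reasoning
  xs⊆as++bs : xs ⊆ as ++ bs
  xs⊆as++bs z∈xs with ∈-++⁻ as (xs⊆ys (there z∈xs))
  ... | inj₁ z∈as         = ∈-++⁺ˡ z∈as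
  ... | inj₂ (here z≡x)   = contradiction (sym z≡x) (All.lookup x∉xs z∈xs)
  ... | inj₂ (there z∈bs) = ∈-++⁺ʳ as z∈bs

module _ (_≟_ : DecidableEquality A) where

  open DecMembership _≟_ using (_∈?_; _∉?_)

  extendUnique : ∀ {xs us : List A} {p} → Unique xs → Unique us → length xs ≤ p → p ≤ length us →
                 ∃ λ zs → Unique zs × length zs ≡ p × xs ⊆ zs
  extendUnique {xs} {us} {p} xs! us! xs≤p p≤us =
    xs ++ fresh , Unique.++⁺ xs! (Unique.take⁺ k (Unique.filter⁺ (_∉? xs) us!)) disjoint ,
    length≡p , ∈-++⁺ˡ
    where
    k = p ∸ length xs
    others = filter (_∉? xs) us
    fresh = take k others
    open ≤-Reasoning

    us⊆ : us ⊆ xs ++ others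
    us⊆ {u} u∈us with u ∈? xs
    ... | yes u∈xs = ∈-++⁺ˡ u∈xs
    ... | no  u∉xs = ∈-++⁺ʳ xs (∈-filter⁺ (_∉? xs) u∈us u∉xs)

    k≤others : k ≤ length others
    k≤others = m≤n+o⇒m∸n≤o p (length xs) (begin
      p                          ≤⟨ p≤us ⟩
      length us                  ≤⟨ unique-⊆⇒length≤ us! us⊆ ⟩
      length (xs ++ others)      ≡⟨ List.length-++ xs ⟩
      length xs + length others  ∎)

    length≡p : length (xs ++ fresh) ≡ p
    length≡p = begin-equality
      length (xs ++ fresh)      ≡⟨ List.length-++ xs ⟩
      length xs + length fresh  ≡⟨ cong (length xs +_) (trans (List.length-take k others) (m≤n⇒m⊓n≡m k≤others)) ⟩
      length xs + k             ≡⟨ m+[n∸m]≡n xs≤p ⟩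
      p                         ∎

    take-⊆ : ∀ j {zs : List A} {z} → z ∈ take j zs → z ∈ zs
    take-⊆ (suc j) {_ ∷ _} (here eq)  = here eq
    take-⊆ (suc j) {_ ∷ _} (there z∈) = there (take-⊆ j z∈)

    disjoint : ∀ {z} → ¬ (z ∈ xs × z ∈ fresh)
    disjoint (z∈xs , z∈fresh) = proj₂ (∈-filter⁻ (_∉? xs) {xs = us} (take-⊆ k z∈fresh)) z∈xs

length-concatMap≤ : ∀ (f : A → List B) xs {b} → (∀ x → length (f x) ≤ b) →
  length (concatMap f xs) ≤ length xs * b
length-concatMap≤ f []       _     = z≤n
length-concatMap≤ f (x ∷ xs) small rewrite List.length-++ (f x) {concatMap f xs} =
  +-mono-≤ (small x) (length-concatMap≤ f xs small)

length-allFin : ∀ n → length (allFin n) ≡ n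
length-allFin n = List.length-tabulate {n = n} (λ c → c)

length≤colours*bound : ∀ {D} (f : A → Fin D) {xs : List A} {b} → Unique xs →
  (∀ c → length (filter (λ x → f x Fin.≟ c) xs) ≤ b) → length xs ≤ D * b
length≤colours*bound {D = D} f {xs} {b} xs! small = begin
  length xs                             ≤⟨ unique-⊆⇒length≤ xs! covered ⟩
  length (concatMap class (allFin D))   ≤⟨ length-concatMap≤ class (allFin D) small ⟩
  length (allFin D) * b                 ≡⟨ cong (_* b) (length-allFin D) ⟩
  D * b                                 ∎
  where
  open ≤-Reasoning
  class : Fin D → List _
  class c = filter (λ x → f x Fin.≟ c) xs
  covered : xs ⊆ concatMap class (allFin D)
  covered {x} x∈xs = ∈-concatMap⁺ class (lose (∈-allFin (f x)) (∈-filter⁺ _ x∈xs refl))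

-- Families of bit strings

2^-cancel-< : ∀ {j k} → 2 ^ j < 2 ^ k → j < k
2^-cancel-< lt = ≰⇒> (λ k≤j → <⇒≱ lt (^-monoʳ-≤ 2 k≤j))

words : ℕ → List (List Bool)
words zero    = [ [] ]
words (suc l) = map (true ∷_) (words l) ++ map (false ∷_) (words l)

length-double : ∀ (f g : A → B) xs → length (map f xs ++ map g xs) ≡ 2 * length xs
length-double f g xs rewrite List.length-++ (map f xs) {map g xs}
  | List.length-map f xs | List.length-map g xs | +-identityʳ (length xs) = refl

length-words : ∀ l → length (words l) ≡ 2 ^ l
length-words zero    = refl
length-words (suc l) = trans (length-double _ _ (words l)) (cong (2 *_) (length-words l))

words-unique : ∀ l → Unique (words l)
words-unique zero    = [] ∷ []
words-unique (suc l) = Unique.++⁺ (Unique.map⁺ List.∷-injectiveʳ (words-unique l))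
  (Unique.map⁺ List.∷-injectiveʳ (words-unique l)) disjoint
  where
  disjoint : ∀ {w} → ¬ (w ∈ map (true ∷_) (words l) × w ∈ map (false ∷_) (words l))
  disjoint (w∈ , w∈′) with ∈-map⁻ _ w∈ | ∈-map⁻ _ w∈′
  ... | _ , _ , refl | _ , _ , ()

words-length : ∀ l → All (λ w → length w ≡ l) (words l)
words-length zero    = refl ∷ []
words-length (suc l) = All.++⁺ (All.map⁺ (All.map (cong suc) (words-length l)))
                               (All.map⁺ (All.map (cong suc) (words-length l)))

wordsUpTo : ℕ → List (List Bool)
wordsUpTo zero    = [ [] ]
wordsUpTo (suc b) = [] ∷ map (true ∷_) (wordsUpTo b) ++ map (false ∷_) (wordsUpTo b)

length-wordsUpTo : ∀ b → suc (length (wordsUpTo b)) ≡ 2 ^ suc b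
length-wordsUpTo zero    = refl
length-wordsUpTo (suc b) = begin
  2 + length (map (true ∷_) ws ++ map (false ∷_) ws)  ≡⟨ cong (2 +_) (length-double _ _ ws) ⟩
  2 + 2 * length ws                                   ≡⟨ *-suc 2 (length ws) ⟨
  2 * suc (length ws)                                 ≡⟨ cong (2 *_) (length-wordsUpTo b) ⟩
  2 ^ suc (suc b)                                     ∎
  where
  open ≡-Reasoning
  ws = wordsUpTo b

∈-wordsUpTo : ∀ {b} w → length w ≤ b → w ∈ wordsUpTo b
∈-wordsUpTo {zero}  []          _         = here refl
∈-wordsUpTo {suc b} []          _         = here refl
∈-wordsUpTo {suc b} (true  ∷ w) (s≤s w≤b) = there (∈-++⁺ˡ (∈-map⁺ _ (∈-wordsUpTo w w≤b)))
∈-wordsUpTo {suc b} (false ∷ w) (s≤s w≤b) =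
  there (∈-++⁺ʳ (map (true ∷_) (wordsUpTo b)) (∈-map⁺ _ (∈-wordsUpTo w w≤b)))

-- Bit assignments on a list

module _ (_≟_ : DecidableEquality A) where

  update : A → Bool → (A → Bool) → A → Bool
  update a β x a′ = if does (a ≟ a′) then β else x a′

  update-≡ : ∀ a β x → update a β x a ≡ β
  update-≡ a β x rewrite dec-true (a ≟ a) refl = refl

  update-≢ : ∀ {a a′} β x → a ≢ a′ → update a β x a′ ≡ x a′
  update-≢ {a} {a′} β x a≢a′ rewrite dec-false (a ≟ a′) a≢a′ = refl

  assignments : List A → List (A → Bool)
  assignments []       = [ (λ _ → false) ]
  assignments (a ∷ as) = map (update a true) (assignments as) ++ map (update a false) (assignments as)

  length-assignments : ∀ as → length (assignments as) ≡ 2 ^ length as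
  length-assignments []       = refl
  length-assignments (a ∷ as) =
    trans (length-double _ _ (assignments as)) (cong (2 *_) (length-assignments as))

  -- The witness is kept inside the list because it is the edge on which two gadgets disagree and
  -- whose criticality is then used.
  DifferOn : List A → (A → Bool) → (A → Bool) → Set
  DifferOn as x y = ∃ λ a → a ∈ as × x a ≢ y a

  assignments-differ : ∀ {as} → Unique as → AllPairs (DifferOn as) (assignments as)
  assignments-differ [] = [] ∷ []
  assignments-differ {a ∷ as} (a∉as ∷ as!) = AllPairs.++⁺ (same true) (same false)
    (All.map⁺ (All.universal (λ x → All.map⁺ (All.universal (across x) _)) _))
    where
    same : ∀ β → AllPairs (DifferOn (a ∷ as)) (map (update a β) (assignments as))
    same β = AllPairs.map⁺ (AllPairs.map extend (assignments-differ as!))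
      where
      extend : ∀ {x y} → DifferOn as x y → DifferOn (a ∷ as) (update a β x) (update a β y)
      extend {x} {y} (a′ , a′∈as , xa′≢ya′) = a′ , there a′∈as ,
        subst₂ _≢_ (sym (update-≢ β x a≢a′)) (sym (update-≢ β y a≢a′)) xa′≢ya′
        where a≢a′ = All.lookup a∉as a′∈as
    across : ∀ x y → DifferOn (a ∷ as) (update a true x) (update a false y)
    across x y = a , here refl , subst₂ _≢_ (sym (update-≡ a true x)) (sym (update-≡ a false y)) λ ()

-- Edges and reachability

_≟ₚ_ : DecidableEquality (Fin n × Fin n)
_≟ₚ_ = ≡-dec Fin._≟_ Fin._≟_

module _ {n : ℕ} where
  open DecMembership (_≟ₚ_ {n}) public using () renaming (_∈?_ to _∈ₚ?_)

allPairs : ∀ n → List (Fin n × Fin n)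
allPairs n = cartesianProduct (allFin n) (allFin n)

allPairs-unique : ∀ n → Unique (allPairs n)
allPairs-unique n = Unique.cartesianProduct⁺ (Unique.allFin⁺ n) (Unique.allFin⁺ n)

∈-allPairs : (e : Fin n × Fin n) → e ∈ allPairs n
∈-allPairs (u , v) = ∈-cartesianProduct⁺ (∈-allFin u) (∈-allFin v)

length-allPairs : ∀ n → length (allPairs n) ≡ n * n
length-allPairs n = trans (length-product (allFin n) (allFin n))
  (cong₂ _*_ (length-allFin n) (length-allFin n))
  where
  length-product : ∀ (xs : List A) (ys : List B) → length (cartesianProduct xs ys) ≡ length xs * length ys
  length-product []       ys = refl
  length-product (x ∷ xs) ys = trans (List.length-++ (map (x ,_) ys))
    (cong₂ _+_ (List.length-map (x ,_) ys) (length-product xs ys))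

IsEdge : Graph n → Fin n × Fin n → Set
IsEdge H (u , v) = Edge H u v

isEdge? : (H : Graph n) → Decidable (IsEdge H)
isEdge? H (u , v) = H u v Bool.≟ true

edges : Graph n → List (Fin n × Fin n)
edges {n} H = filter (isEdge? H) (allPairs n)

edges-unique : (H : Graph n) → Unique (edges H)
edges-unique {n} H = Unique.filter⁺ (isEdge? H) (allPairs-unique n)

∈-edges⁺ : (H : Graph n) {e : Fin n × Fin n} → IsEdge H e → e ∈ edges H
∈-edges⁺ H {e} He = ∈-filter⁺ (isEdge? H) (∈-allPairs e) He

∈-edges⁻ : (H : Graph n) {e : Fin n × Fin n} → e ∈ edges H → IsEdge H e
∈-edges⁻ {n} H e∈ = proj₂ (∈-filter⁻ (isEdge? H) {xs = allPairs n} e∈)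

length-edges : (H : Graph n) → length (edges H) ≡ edgeCount H
length-edges {n} H = rows (allFin n)
  where
  indicator : Fin n → Fin n → ℕ
  indicator u v = if H u v then 1 else 0

  row : ∀ u vs → length (filter (isEdge? H) (map (u ,_) vs)) ≡ sum (map (indicator u) vs)
  row u []       = refl
  row u (v ∷ vs) with H u v
  ... | true  = cong suc (row u vs)
  ... | false = row u vs

  rows : ∀ us → length (filter (isEdge? H) (cartesianProduct us (allFin n))) ≡
                sum (map (λ u → sum (map (indicator u) (allFin n))) us)
  rows []       = refl
  rows (u ∷ us) = begin
    length (filter (isEdge? H) (first ++ rest))                           ≡⟨ cong length (List.filter-++ (isEdge? H) first rest) ⟩
    length (filter (isEdge? H) first ++ filter (isEdge? H) rest)          ≡⟨ List.length-++ (filter (isEdge? H) first) ⟩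
    length (filter (isEdge? H) first) + length (filter (isEdge? H) rest)  ≡⟨ cong₂ _+_ (row u (allFin n)) (rows us) ⟩
    sum (map (λ u → sum (map (indicator u) (allFin n))) (u ∷ us))         ∎
    where
    open ≡-Reasoning
    first = map (u ,_) (allFin n)
    rest = cartesianProduct us (allFin n)

edgeCount≤n*n : (H : Graph n) → edgeCount H ≤ n * n
edgeCount≤n*n {n} H = begin
  edgeCount H          ≡⟨ length-edges H ⟨
  length (edges H)     ≤⟨ List.length-filter (isEdge? H) (allPairs n) ⟩
  length (allPairs n)  ≡⟨ length-allPairs n ⟩
  n * n                ∎
  where open ≤-Reasoning

-- Reachability is decided by the Floyd–Warshall recursion on the set of
-- permitted intermediate vertices.
module _ (G : Graph n) where

  Via : List (Fin n) → Fin n → Fin n → Set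
  Via []       s t = s ≡ t ⊎ Edge G s t
  Via (w ∷ ws) s t = Via ws s t ⊎ (Via ws s w × Via ws w t)

  via? : ∀ ws s t → Dec (Via ws s t)
  via? []       s t = (s Fin.≟ t) ⊎-dec (G s t Bool.≟ true)
  via? (w ∷ ws) s t = via? ws s t ⊎-dec (via? ws s w ×-dec via? ws w t)

  via⇒reach : ∀ ws {s t} → Via ws s t → Reach G s t
  via⇒reach []       (inj₁ refl)    = ε
  via⇒reach []       (inj₂ e)       = e ◅ ε
  via⇒reach (w ∷ ws) (inj₁ p)       = via⇒reach ws p
  via⇒reach (w ∷ ws) (inj₂ (p , q)) = via⇒reach ws p ◅◅ via⇒reach ws q

  via-base : ∀ ws {s t} → Via [] s t → Via ws s t
  via-base []       p = p
  via-base (w ∷ ws) p = inj₁ (via-base ws p)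

  via-into : ∀ ws {w s} → Via (w ∷ ws) s w → Via ws s w
  via-into ws (inj₁ p)       = p
  via-into ws (inj₂ (p , _)) = p

  via-from : ∀ ws {w t} → Via (w ∷ ws) w t → Via ws w t
  via-from ws (inj₁ p)       = p
  via-from ws (inj₂ (_ , p)) = p

  -- When both paths pass through `x`, everything between the two visits, `w` included, is cut out,
  -- so a single passage through `x` remains.
  via-trans : ∀ ws {s w t} → w ∈ ws → Via ws s w → Via ws w t → Via ws s t
  via-trans (x ∷ ws) (here refl) p q = inj₂ (via-into ws p , via-from ws q)
  via-trans (x ∷ ws) (there w∈)  (inj₁ p)        (inj₁ q)        = inj₁ (via-trans ws w∈ p q)
  via-trans (x ∷ ws) (there w∈)  (inj₁ p)        (inj₂ (q , q′)) = inj₂ (via-trans ws w∈ p q , q′)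
  via-trans (x ∷ ws) (there w∈)  (inj₂ (p , p′)) (inj₁ q)        = inj₂ (p , via-trans ws w∈ p′ q)
  via-trans (x ∷ ws) (there w∈)  (inj₂ (p , _))  (inj₂ (_ , q′)) = inj₂ (p , q′)

  reach⇒via : ∀ {s t} → Reach G s t → Via (allFin n) s t
  reach⇒via ε               = via-base (allFin n) (inj₁ refl)
  reach⇒via (_◅_ {j = w} e p) =
    via-trans (allFin n) (∈-allFin w) (via-base (allFin n) (inj₂ e)) (reach⇒via p)

  reach? : ∀ s t → Dec (Reach G s t)
  reach? s t = map′ (via⇒reach (allFin n)) reach⇒via (via? (allFin n) s t)

reach-mono : {G H : Graph n} → H ⊆G G → ∀ {s t} → Reach H s t → Reach G s t
reach-mono H⊆G = gmap (λ u → u) (λ {u} {v} → H⊆G u v)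

pathList : {G : Graph n} {s t : Fin n} → Reach G s t → ∃ λ vs → IsPathList G s vs t
pathList ε = [] , refl
pathList (_◅_ {j = v} e p) with pathList p
... | vs , path = v ∷ vs , e , path

-- Critical edges

_∖_ : Graph n → List (Fin n × Fin n) → Graph n
(H ∖ es) u v = H u v ∧ not (does ((u , v) ∈ₚ? es))

edge-∖⁺ : ∀ (H : Graph n) es {u v} → Edge H u v → (u , v) ∉ es → Edge (H ∖ es) u v
edge-∖⁺ H es {u} {v} Huv e∉es rewrite Huv | dec-false ((u , v) ∈ₚ? es) e∉es = refl

edge-∖⁻ : ∀ (H : Graph n) es {u v} → Edge (H ∖ es) u v → Edge H u v × (u , v) ∉ es
edge-∖⁻ H es {u} {v} e with H u v | (u , v) ∈ₚ? es
... | true | no e∉es = refl , e∉es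

∖-⊆ : (H : Graph n) (es : List (Fin n × Fin n)) → (H ∖ es) ⊆G H
∖-⊆ H es u v = proj₁ ∘ edge-∖⁻ H es

∖-mono : {H H′ : Graph n} {es es′ : List (Fin n × Fin n)} → H ⊆G H′ → es′ ⊆ es → (H ∖ es) ⊆G (H′ ∖ es′)
∖-mono {H = H} {H′} {es} {es′} H⊆H′ es′⊆es u v e with edge-∖⁻ H es e
... | Huv , e∉es = edge-∖⁺ H′ es′ (H⊆H′ u v Huv) (e∉es ∘ es′⊆es)

weaken : ∀ (H : Graph n) es {e s t} → e ∈ es → Reach (H ∖ es) s t → Reach (H ∖ [ e ]) s t
weaken H es e∈ = reach-mono (∖-mono {H = H} {es = es} {[ _ ]} (λ _ _ e → e) (λ where (here refl) → e∈))

Critical : Graph n → List (Fin n × Fin n) → Fin n × Fin n → Set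
Critical H P e = ∃₂ λ s t → (s , t) ∈ P × Reach H s t × ¬ Reach (H ∖ [ e ]) s t

-- The pair that witnesses criticality stays reachable because it is preserved, and deleting `e`
-- still breaks it because `H` has no edge beyond those of `G`. Hence one pass over the edges
-- suffices for pruning.
critical-preserver : ∀ {G H : Graph n} {P e} → IsReachPreserver G P H → Critical G P e → Critical H P e
critical-preserver {e = e} (H⊆G , keeps) (s , t , st∈P , reach , broken) =
  s , t , st∈P , keeps s t st∈P reach , broken ∘ reach-mono (∖-mono {es = [ e ]} {[ e ]} H⊆G (λ e∈ → e∈))

deletable-or-critical : ∀ (H : Graph n) P e → IsReachPreserver H P (H ∖ [ e ]) ⊎ Critical H P e
deletable-or-critical H P e
  with All.all? (λ (s , t) → reach? H s t →-dec reach? (H ∖ [ e ]) s t) P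
... | yes keeps = inj₁ (∖-⊆ H [ e ] , λ s t st∈P → All.lookup keeps st∈P)
... | no ¬keeps with find (All.¬All⇒Any¬ (λ (s , t) → reach? H s t →-dec reach? (H ∖ [ e ]) s t) P ¬keeps)
...   | (s , t) , st∈P , fails with reach? H s t
...     | yes reach = inj₂ (s , t , st∈P , reach , λ r → fails (λ _ → r))
...     | no ¬reach = ⊥-elim (fails (⊥-elim ∘ ¬reach))

preserver-trans : ∀ {G H K : Graph n} {P} → IsReachPreserver G P H → IsReachPreserver H P K → IsReachPreserver G P K
preserver-trans (H⊆G , keepsH) (K⊆H , keepsK) =
  (λ u v → H⊆G u v ∘ K⊆H u v) , λ s t st∈P → keepsK s t st∈P ∘ keepsH s t st∈P

pruneOn : ∀ (G : Graph n) P es →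
  ∃ λ H → IsReachPreserver G P H × (∀ {e} → e ∈ es → IsEdge H e → Critical H P e)
pruneOn G P [] = G , ((λ _ _ e → e) , λ _ _ _ r → r) , λ ()
pruneOn G P (e ∷ es) with deletable-or-critical G P e
... | inj₂ crit with pruneOn G P es
...   | H , preserves , critical = H , preserves , λ where
          (here refl) _ → critical-preserver preserves crit
          (there e∈)    → critical e∈
pruneOn G P (e ∷ es) | inj₁ deletable with pruneOn (G ∖ [ e ]) P es
...   | H , preserves , critical = H , preserver-trans deletable preserves , λ where
          -- A deleted edge never comes back: whatever is kept later is a subgraph of `G ∖ [ e ]`.
          (here refl) He → contradiction (here refl) (proj₂ (edge-∖⁻ G [ e ] (proj₁ preserves _ _ He)))
          (there e∈)     → critical e∈

prune : ∀ (G : Graph n) P → ∃ λ H → IsReachPreserver G P H × (∀ e → IsEdge H e → Critical H P e)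
prune {n} G P with pruneOn G P (allPairs n)
... | H , preserves , critical = H , preserves , λ e → critical (∈-allPairs e)

-- Oracles distinguish separated graphs

-- The obstruction to sharing an oracle string: reachability in `G₁` excludes the answer `nothing`,
-- and a reported path would have to run in both graphs.
Separated : List (Fin n × Fin n) → Graph n → Graph n → Set
Separated P G₁ G₂ = ∃₂ λ s t →
  (s , t) ∈ P × Reach G₁ s t × ¬ Star (λ u v → Edge G₁ u v × Edge G₂ u v) s t

commonPath : ∀ {G₁ G₂ : Graph n} vs {s t} → IsPathList G₁ s vs t → IsPathList G₂ s vs t →
             Star (λ u v → Edge G₁ u v × Edge G₂ u v) s t
commonPath []       refl      _         = ε
commonPath (v ∷ vs) (e₁ , p₁) (e₂ , p₂) = (e₁ , e₂) ◅ commonPath vs p₁ p₂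

-- The query algorithm is fixed once `P` is, so pairwise separated graphs get pairwise distinct
-- strings of length at most `b`, of which there are 2 ^ (b + 1) - 1.
separated-family-bound : ∀ {p b} → POBound n p b → (P : DemandPairs n p) (Gs : List (Graph n)) →
  AllPairs (Separated (pairsOf P)) Gs → length Gs < 2 ^ suc b
separated-family-bound {n} {b = b} oracle P Gs separated = begin
  suc (length Gs)             ≡⟨ cong suc (List.length-map code Gs) ⟨
  suc (length (map code Gs))  ≤⟨ s≤s (unique-⊆⇒length≤ codes-unique codes⊆) ⟩
  suc (length (wordsUpTo b))  ≡⟨ length-wordsUpTo b ⟩
  2 ^ suc b                   ∎
  where
  open ≤-Reasoning
  query = proj₁ (oracle P)
  code : Graph n → List Bool
  code G = proj₁ (proj₂ (oracle P) G)

  code-short : ∀ G → length (code G) ≤ b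
  code-short G = proj₁ (proj₂ (proj₂ (oracle P) G))

  correct : ∀ G s t → (s , t) ∈ pairsOf P → CorrectAnswer G s t (query (code G) s t)
  correct G = proj₂ (proj₂ (proj₂ (oracle P) G))

  codes-differ : ∀ {G₁ G₂} → Separated (pairsOf P) G₁ G₂ → code G₁ ≢ code G₂
  codes-differ {G₁} {G₂} (s , t , st∈P , reach , apart) code≡
    with query (code G₁) s t | correct G₁ s t st∈P
       | subst (λ c → CorrectAnswer G₂ s t (query c s t)) (sym code≡) (correct G₂ s t st∈P)
  ... | just vs | path₁ | path₂ = apart (commonPath vs path₁ path₂)
  ... | nothing | ¬reach | _    = ¬reach reach

  codes-unique : Unique (map code Gs)
  codes-unique = AllPairs.map⁺ (AllPairs.map codes-differ separated)

  codes⊆ : map code Gs ⊆ wordsUpTo b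
  codes⊆ c∈ with ∈-map⁻ code c∈
  ... | G , _ , refl = ∈-wordsUpTo (code G) (code-short G)

critical⇒1≤b : ∀ {p b} → POBound n p b → (P : DemandPairs n p) (H : Graph n) {e : Fin n × Fin n} →
  Critical H (pairsOf P) e → 1 ≤ b
critical⇒1≤b {b = zero} oracle P H {e} (s , t , st∈P , reach , broken)
  -- For `b = 0` a separated family has fewer than `2 ^ 1` members, yet `H` and `H ∖ [ e ]` form one
  -- with two.
  with s≤s (s≤s ()) ← separated-family-bound oracle P (H ∷ H ∖ [ e ] ∷ [])
    (((s , t , st∈P , reach , broken ∘ gmap (λ u → u) proj₂) ∷ []) ∷ [] ∷ [])
critical⇒1≤b {b = suc b} _ _ _ _ = s≤s z≤n

-- The gadget

-- The two heads of v are the two targets selected by a bit.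
data Node (n : ℕ) : Set where
  tail : Fin n → Node n
  head : Bool → Fin n → Node n

base : Node n → Fin n
base (tail u)   = u
base (head _ v) = v

-- Nothing is asked of `node` here: vertices that repeat a node are harmless,
-- since every gadget path projects along `base`.
module Gadget (H : Graph n) (es : List (Fin n × Fin n)) (node : Fin n → Node n) where

  -- The bit sends `(u , v)` to one copy of `v`, and the `true` copy leads on to the `false` copy.
  -- So `head false v` is the common exit whatever the bit, and demand pairs can be chosen
  -- independently of `x`.
  link : (Fin n × Fin n → Bool) → Node n → Node n → Bool
  link x (tail u)       (head β v)      = does ((u , v) ∈ₚ? es) ∧ does (x (u , v) Bool.≟ β)
  link x (head true v)  (head false v′) = does (v Fin.≟ v′)
  link x (head false v) (tail u)        = does (reach? (H ∖ es) v u)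
  link x _              _               = false

  gadget : (Fin n × Fin n → Bool) → Graph n
  gadget x a b = link x (node a) (node b)

  -- The part of a path from the tail of its first es-edge to the head of its last one.
  data Hops : Fin n → Fin n → Set where
    last : ∀ {u v} → (u , v) ∈ es → Hops u v
    step : ∀ {u v u′ v′} → (u , v) ∈ es → Reach (H ∖ es) v u′ → Hops u′ v′ → Hops u v′

  Decomposition : Fin n → Fin n → Set
  Decomposition s t = ∃₂ λ u v → Reach (H ∖ es) s u × Hops u v × Reach (H ∖ es) v t

  decompose : ∀ {s t} → Reach H s t → Reach (H ∖ es) s t ⊎ Decomposition s t
  decompose ε = inj₁ ε
  decompose (_◅_ {i = s} {j = w} e π) with (s , w) ∈ₚ? es | decompose π
  ... | yes sw∈ | inj₁ r                     = inj₂ (s , w , ε , last sw∈ , r)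
  ... | yes sw∈ | inj₂ (u , v , r , hops , r′) = inj₂ (s , v , ε , step sw∈ r hops , r′)
  ... | no sw∉  | inj₁ r                     = inj₁ (edge-∖⁺ H es e sw∉ ◅ r)
  ... | no sw∉  | inj₂ (u , v , r , hops , r′) = inj₂ (u , v , edge-∖⁺ H es e sw∉ ◅ r , hops , r′)

  module _ (es-edges : ∀ {e} → e ∈ es → IsEdge H e) where

    -- A tail-to-head edge present under both assignments carries a bit on which they agree, so it
    -- is not `e`. An edge between the two copies of a vertex collapses to a point, and a link back
    -- to a tail stands for a walk avoiding all of `es`, hence `e`.
    link-project : ∀ {x y e} → e ∈ es → x e ≢ y e → ∀ μ ν → link x μ ν ≡ true → link y μ ν ≡ true →
                   Reach (H ∖ [ e ]) (base μ) (base ν)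
    link-project {x} {y} {e} e∈ x≢y (tail u) (head β v) lx ly
      with (u , v) ∈ₚ? es | x (u , v) Bool.≟ β | y (u , v) Bool.≟ β
    ... | yes uv∈ | yes xβ | yes yβ = edge-∖⁺ H [ e ] (es-edges uv∈) (λ where
            (here refl) → x≢y (trans xβ (sym yβ))) ◅ ε
    link-project e∈ x≢y (head true v) (head false v′) lx _ with v Fin.≟ v′
    ... | yes refl = ε
    link-project e∈ x≢y (head false v) (tail u) lx _ =
      weaken H es e∈ (does-true (reach? (H ∖ es) v u) lx)

    gadget-project : ∀ {x y e} → e ∈ es → x e ≢ y e → ∀ {a b} →
      Star (λ a b → Edge (gadget x) a b × Edge (gadget y) a b) a b →
      Reach (H ∖ [ e ]) (base (node a)) (base (node b))
    gadget-project e∈ x≢y =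
      kleisliStar (base ∘ node) (λ {a} {b} (ex , ey) → link-project e∈ x≢y (node a) (node b) ex ey)

    -- `slot` is a section of `node` at the ends of edges of `es`; the paths built below visit no
    -- other nodes.
    module _ (slot : Node n → Fin n)
             (node-tail : ∀ {u v} → (u , v) ∈ es → node (slot (tail u)) ≡ tail u)
             (node-head : ∀ {u v} β → (u , v) ∈ es → node (slot (head β v)) ≡ head β v) where

      hops-tail : ∀ {u v} → Hops u v → node (slot (tail u)) ≡ tail u
      hops-tail (last uv∈)     = node-tail uv∈
      hops-tail (step uv∈ _ _) = node-tail uv∈

      hops-head : ∀ {u v} → Hops u v → node (slot (head false v)) ≡ head false v
      hops-head (last uv∈)      = node-head false uv∈
      hops-head (step _ _ hops) = hops-head hops

      cross : ∀ x {u v} → (u , v) ∈ es → Reach (gadget x) (slot (tail u)) (slot (head false v))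
      cross x {u} {v} uv∈ = go (x (u , v)) refl
        where
        fork : ∀ β → x (u , v) ≡ β → Edge (gadget x) (slot (tail u)) (slot (head β v))
        fork β xβ rewrite node-tail uv∈ | node-head β uv∈
          | dec-true ((u , v) ∈ₚ? es) uv∈ | dec-true (x (u , v) Bool.≟ β) xβ = refl
        merge : Edge (gadget x) (slot (head true v)) (slot (head false v))
        merge rewrite node-head true uv∈ | node-head false uv∈ | dec-true (v Fin.≟ v) refl = refl
        go : ∀ β → x (u , v) ≡ β → Reach (gadget x) (slot (tail u)) (slot (head false v))
        go false xβ = fork false xβ ◅ ε
        go true  xβ = fork true xβ ◅ merge ◅ ε

      hops⇒reach : ∀ x {u v} → Hops u v → Reach (gadget x) (slot (tail u)) (slot (head false v))
      hops⇒reach x (last uv∈) = cross x uv∈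
      hops⇒reach x (step {v = v} {u′} uv∈ r hops) = cross x uv∈ ◅◅ jump ◅ hops⇒reach x hops
        where
        jump : Edge (gadget x) (slot (head false v)) (slot (tail u′))
        jump rewrite node-head false uv∈ | hops-tail hops | dec-true (reach? (H ∖ es) v u′) r = refl

      -- The pair (s , t) itself is a junk value, for pairs that no edge of es matters to.
      demand : Fin n × Fin n → Fin n × Fin n
      demand (s , t) with reach? H s t
      ... | no _  = s , t
      ... | yes π with decompose π
      ...   | inj₁ _           = s , t
      ...   | inj₂ (u , v , _) = slot (tail u) , slot (head false v)

      -- The decomposed path is the one that `reach?` finds, so the demand depends on `(s , t)`
      -- alone and one demand set serves all gadgets. That path must use an edge of `es`, as
      -- otherwise it would survive the deletion of `e`.
      demand-spec : ∀ {s t e} → e ∈ es → Reach H s t → ¬ Reach (H ∖ [ e ]) s t →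
        Σ (Decomposition s t) λ (u , v , _) → demand (s , t) ≡ (slot (tail u) , slot (head false v))
      demand-spec {s} {t} {e} e∈ reach broken with reach? H s t
      ... | no ¬reach = contradiction reach ¬reach
      ... | yes π with decompose π
      ...   | inj₁ r = ⊥-elim (broken (weaken H es e∈ r))
      ...   | inj₂ d = d , refl

      gadgets-separated : ∀ {P P′ x y} → (∀ {e} → e ∈ es → Critical H P e) → map demand P ⊆ P′ →
        DifferOn _≟ₚ_ es x y → Separated P′ (gadget x) (gadget y)
      gadgets-separated {P} {P′} {x} {y} critical P⊆P′ (e , e∈ , x≢y)
        with critical e∈
      ... | s , t , st∈P , reach , broken with demand-spec e∈ reach broken
      ...   | (u , v , r , hops , r′) , demand≡ =
        slot (tail u) , slot (head false v) ,
        subst (_∈ P′) demand≡ (P⊆P′ (∈-map⁺ demand st∈P)) ,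
        hops⇒reach x hops ,
        -- A path common to both gadgets projects to a walk from `u` to `v` avoiding `e`; together
        -- with the outer walks, which avoid `es`, it would reconnect `s` to `t`.
        λ common → broken (weaken H es e∈ r ◅◅
          subst₂ (Reach (H ∖ [ e ])) (cong base (hops-tail hops)) (cong base (hops-head hops))
            (gadget-project e∈ x≢y common) ◅◅ weaken H es e∈ r′)

      critical-class-bound : ∀ {p b} → POBound n p b → p ≤ n * n → (P : DemandPairs n p) →
        Unique es → (∀ {e} → e ∈ es → Critical H (pairsOf P) e) → length es ≤ b
      critical-class-bound {p} {b} oracle p≤n² (P , P! , P≡p) es! critical
        -- Different pairs of `P` can yield the same demand, so duplicates are removed and the list
        -- is then padded to exactly `p` pairs, for which `p ≤ n * n` leaves room.
        with extendUnique _≟ₚ_ (DecUnique.deduplicate-! _≟ₚ_ (map demand P)) (allPairs-unique n)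
               (≤-trans (List.length-deduplicate _≟ₚ_ (map demand P))
                        (≤-reflexive (trans (List.length-map demand P) P≡p)))
               (≤-trans p≤n² (≤-reflexive (sym (length-allPairs n))))
      ... | P′ , P′! , P′≡p , ⊆P′ = ≤-pred (2^-cancel-< (begin-strict
        2 ^ length es               ≡⟨ length-assignments _≟ₚ_ es ⟨
        length family               ≡⟨ List.length-map gadget family ⟨
        length (map gadget family)  <⟨ separated-family-bound oracle (P′ , P′! , P′≡p) (map gadget family)
          (AllPairs.map⁺ (AllPairs.map
            (gadgets-separated critical (⊆P′ ∘ ∈-deduplicate⁺ _≟ₚ_))
            (assignments-differ _≟ₚ_ es!))) ⟩
        2 ^ suc b                   ∎))
        where
        open ≤-Reasoning
        family = assignments _≟ₚ_ es

-- Fitting the gadgets into n vertices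

-- A left inverse of `inject≤` made total: indices out of range go to the default `zero`.
restrict : ∀ {m} → Fin n → Fin (suc m)
restrict {m = m} j with toℕ j <? suc m
... | yes j<m = fromℕ< j<m
... | no  _   = zero

restrict-inject≤ : ∀ {m} (i : Fin (suc m)) .(m≤n : suc m ≤ n) → restrict (inject≤ i m≤n) ≡ i
restrict-inject≤ {n} {m} i m≤n with toℕ (inject≤ i m≤n) <? suc m
... | yes lt = Fin.toℕ-injective (trans (Fin.toℕ-fromℕ< lt) (Fin.toℕ-inject≤ i m≤n))
... | no ≮   = contradiction (subst (_< suc m) (sym (Fin.toℕ-inject≤ i m≤n)) (Fin.toℕ<n i)) ≮

-- `q` is the capacity of a colour class. Six classes must cover all vertices, and three blocks of
-- `q` slots, one for tails and two for the copies of heads, must fit among them.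
module Slots {m q-1 : ℕ} (3q≤n : 3 * suc q-1 ≤ suc m) (n≤6q : suc m ≤ 6 * suc q-1) where

  private q = suc q-1

  locate : Fin (suc m) → Fin 6 × Fin q
  locate u = remQuot q (inject≤ u n≤6q)

  colour : Fin (suc m) → Fin 6
  colour u = proj₁ (locate u)

  vertex : Fin 6 → Fin q → Fin (suc m)
  vertex c ρ = restrict (combine c ρ)

  vertex-locate : ∀ u {c} → colour u ≡ c → vertex c (proj₂ (locate u)) ≡ u
  vertex-locate u refl = trans (cong restrict (Fin.combine-remQuot {6} q (inject≤ u n≤6q))) (restrict-inject≤ u n≤6q)

  pack : Fin 3 → Fin q → Fin (suc m)
  pack k ρ = inject≤ (combine k ρ) 3q≤n

  -- Only the position within a colour class is recorded. The colours come from `node`, where `i` is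
  -- the colour of tails and `j` that of heads; separate blocks keep tails and heads apart even when
  -- `i` and `j` coincide.
  slot : Node (suc m) → Fin (suc m)
  slot (tail u)       = pack zero (proj₂ (locate u))
  slot (head false v) = pack (suc zero) (proj₂ (locate v))
  slot (head true v)  = pack (suc (suc zero)) (proj₂ (locate v))

  module _ (i j : Fin 6) where

    nodeAt : Fin 3 × Fin q → Node (suc m)
    nodeAt (zero , ρ)           = tail (vertex i ρ)
    nodeAt (suc zero , ρ)       = head false (vertex j ρ)
    nodeAt (suc (suc zero) , ρ) = head true (vertex j ρ)

    node : Fin (suc m) → Node (suc m)
    node a = nodeAt (remQuot q (restrict a))

    node-pack : ∀ k ρ → node (pack k ρ) ≡ nodeAt (k , ρ)
    node-pack k ρ = cong nodeAt (trans (cong (remQuot q) (restrict-inject≤ (combine k ρ) 3q≤n)) (Fin.remQuot-combine k ρ))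

    node-tail : ∀ {u} → colour u ≡ i → node (slot (tail u)) ≡ tail u
    node-tail {u} u∈i = trans (node-pack zero _) (cong tail (vertex-locate u u∈i))

    node-head : ∀ {v} β → colour v ≡ j → node (slot (head β v)) ≡ head β v
    node-head {v} false v∈j = trans (node-pack (suc zero) _) (cong (head false) (vertex-locate v v∈j))
    node-head {v} true  v∈j = trans (node-pack (suc (suc zero)) _) (cong (head true) (vertex-locate v v∈j))

  edgeColour : Fin (suc m) × Fin (suc m) → Fin (6 * 6)
  edgeColour (u , v) = combine (colour u) (colour v)

  critical-edges-bound : ∀ {p b} → POBound (suc m) p b → p ≤ suc m * suc m →
    (P : DemandPairs (suc m) p) (H : Graph (suc m)) →
    (∀ e → IsEdge H e → Critical H (pairsOf P) e) → edgeCount H ≤ 36 * b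
  critical-edges-bound {b = b} oracle p≤n² P H critical =
    subst (_≤ 36 * b) (length-edges H) (length≤colours*bound edgeColour (edges-unique H) class-bound)
    where
    class : Fin (6 * 6) → List (Fin (suc m) × Fin (suc m))
    class c = filter (λ e → edgeColour e Fin.≟ c) (edges H)

    class-bound : ∀ c → length (class c) ≤ b
    class-bound c = Gadget.critical-class-bound H (class c) (node i j)
      (∈-edges⁻ H ∘ proj₁ ∘ class⁻) slot
      (λ e∈ → node-tail i j (proj₁ (colours e∈)))
      (λ β e∈ → node-head i j β (proj₂ (colours e∈)))
      oracle p≤n² P (Unique.filter⁺ _ (edges-unique H))
      (λ e∈ → critical _ (∈-edges⁻ H (proj₁ (class⁻ e∈))))
      where
      i = proj₁ (remQuot {6} 6 c)
      j = proj₂ (remQuot {6} 6 c)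
      class⁻ : ∀ {e} → e ∈ class c → e ∈ edges H × edgeColour e ≡ c
      class⁻ = ∈-filter⁻ (λ e → edgeColour e Fin.≟ c) {xs = edges H}
      colours : ∀ {u v} → (u , v) ∈ class c → colour u ≡ i × colour v ≡ j
      colours {u} {v} e∈ with refl ← proj₂ (class⁻ e∈) =
        sym (cong proj₁ (Fin.remQuot-combine (colour u) (colour v))) ,
        sym (cong proj₂ (Fin.remQuot-combine (colour u) (colour v)))

-- The capacity `1 + n / 6` and the lower bound

3*[1+n/6]≤n : ∀ n → 3 ≤ n → 3 * suc (n / 6) ≤ n
3*[1+n/6]≤n n 3≤n with n / 6 | m≡m%n+[m/n]*n n 6
-- For `3 ≤ n < 6` the quotient is zero and the claim is the hypothesis; from 6 on, the extra 3 is
-- absorbed by a second `3 * (n / 6)`.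
... | zero  | _  = 3≤n
... | suc w | eq = begin
  3 * suc (suc w)        ≡⟨ *-suc 3 (suc w) ⟩
  3 + 3 * suc w          ≤⟨ +-monoˡ-≤ (3 * suc w) (m≤m*n 3 (suc w)) ⟩
  3 * suc w + 3 * suc w  ≡⟨ *-distribʳ-+ (suc w) 3 3 ⟨
  6 * suc w              ≡⟨ *-comm 6 (suc w) ⟩
  suc w * 6              ≤⟨ m≤n+m (suc w * 6) (n % 6) ⟩
  n % 6 + suc w * 6      ≡⟨ eq ⟨
  n                      ∎
  where open ≤-Reasoning

n≤6*[1+n/6] : ∀ n → n ≤ 6 * suc (n / 6)
n≤6*[1+n/6] n = begin
  n                    ≡⟨ m≡m%n+[m/n]*n n 6 ⟩
  n % 6 + (n / 6) * 6  ≤⟨ +-monoˡ-≤ ((n / 6) * 6) (<⇒≤ (m%n<n n 6)) ⟩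
  6 + (n / 6) * 6      ≡⟨ *-comm (suc (n / 6)) 6 ⟩
  6 * suc (n / 6)      ∎
  where open ≤-Reasoning

critical-edges-bound : ∀ n {p b} → POBound n p b → p ≤ n * n → (P : DemandPairs n p) (H : Graph n) →
  (∀ e → IsEdge H e → Critical H (pairsOf P) e) → edgeCount H ≤ 36 * b
critical-edges-bound n {b = b} oracle p≤n² P H critical with 3 ≤? n
... | yes 3≤n@(s≤s _) =
  Slots.critical-edges-bound (3*[1+n/6]≤n n 3≤n) (n≤6*[1+n/6] n) oracle p≤n² P H critical
-- Three blocks do not fit below three vertices, but then there are at most 4 edges, and a single
-- critical edge already forces `1 ≤ b`.
... | no 3≰n with edges H | length-edges H | ∈-edges⁻ H
...   | []     | 0≡m | _     = subst (_≤ 36 * b) 0≡m z≤n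
...   | e ∷ _  | _   | edge⁻ = begin
  edgeCount H  ≤⟨ edgeCount≤n*n H ⟩
  n * n        ≤⟨ *-mono-≤ n≤2 n≤2 ⟩
  4            ≤⟨ m≤m+n 4 32 ⟩
  36 * 1       ≤⟨ *-monoʳ-≤ 36 (critical⇒1≤b oracle P H (critical e (edge⁻ (here refl)))) ⟩
  36 * b       ∎
  where
  open ≤-Reasoning
  n≤2 : n ≤ 2
  n≤2 = ≤-pred (≰⇒> 3≰n)

PO⇒RP : ∀ {n p b} → p ≤ n * n → POBound n p b → RPBound n p (36 * b)
PO⇒RP {n} p≤n² oracle G P with prune G (pairsOf P)
... | H , preserves , critical = H , preserves , critical-edges-bound n oracle p≤n² P H critical

-- Storing a preserver as a bit string

take-++ : ∀ {w} (xs : List A) {ys} → length xs ≡ w → take w (xs ++ ys) ≡ xs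
take-++ []       refl = refl
take-++ (x ∷ xs) refl = cong (x ∷_) (take-++ xs refl)

drop-++ : ∀ {w} (xs : List A) {ys} → length xs ≡ w → drop w (xs ++ ys) ≡ ys
drop-++ []       refl = refl
drop-++ (x ∷ xs) refl = drop-++ xs refl

lookup-injective : ∀ {xs : List A} → Unique xs → ∀ i j → lookup xs i ≡ lookup xs j → i ≡ j
lookup-injective (x∉ ∷ _)   zero    zero    _  = refl
lookup-injective (x∉ ∷ _)   zero    (suc j) eq = contradiction eq (All.lookup x∉ (∈-lookup j))
lookup-injective (x∉ ∷ _)   (suc i) zero    eq = contradiction (sym eq) (All.lookup x∉ (∈-lookup i))
lookup-injective (_ ∷ xs!)  (suc i) (suc j) eq = cong suc (lookup-injective xs! i j eq)

-- The number of chunks is an upper bound fixed in advance, as the query algorithm does not know how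
-- many edges were stored; chunks past the end of the string are empty.
chunks : ℕ → ℕ → List A → List (List A)
chunks w zero    xs = []
chunks w (suc r) xs = take w xs ∷ chunks w r (drop w xs)

module _ {w : ℕ} (code : A → List B) (code-length : ∀ a → length (code a) ≡ suc w) where

  ∈-chunks⁺ : ∀ {r c} as → length as ≤ r → c ∈ map code as → c ∈ chunks (suc w) r (concatMap code as)
  ∈-chunks⁺ (a ∷ as) (s≤s as≤r) c∈
    rewrite take-++ (code a) {concatMap code as} (code-length a) | drop-++ (code a) {concatMap code as} (code-length a) with c∈
  ... | here c≡   = here c≡
  ... | there c∈′ = there (∈-chunks⁺ as as≤r c∈′)

  ∈-chunks⁻ : ∀ r {a} as → code a ∈ chunks (suc w) r (concatMap code as) → code a ∈ map code as
  -- An empty surplus chunk matches no code, because codes have the positive length `suc w`.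
  ∈-chunks⁻ (suc r) {a} [] (here a≡) with () ← trans (sym (code-length a)) (cong length a≡)
  ∈-chunks⁻ (suc r) []  (there c∈) = ∈-chunks⁻ r [] c∈
  ∈-chunks⁻ (suc r) (a ∷ as) c∈
    rewrite take-++ (code a) {concatMap code as} (code-length a) | drop-++ (code a) {concatMap code as} (code-length a) with c∈
  ... | here c≡   = here c≡
  ... | there c∈′ = there (∈-chunks⁻ r as c∈′)

n≤2^⌈log₂n⌉ : ∀ n → n ≤ 2 ^ ⌈log₂ n ⌉
n≤2^⌈log₂n⌉ n = go n (<-wellFounded n)
  where
  open ≤-Reasoning
  -- The induction follows the recursion of `⌈log2⌉`, hence the arbitrary accessibility proof.
  go : ∀ n (rec : Acc _<_ n) → n ≤ 2 ^ ⌈log2⌉ n rec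
  go 0             _        = z≤n
  go 1             _        = s≤s z≤n
  go (suc (suc n)) (acc rs) = begin
    2 + n                      ≡⟨ cong (2 +_) (⌊n/2⌋+⌈n/2⌉≡n n) ⟨
    2 + (⌊ n /2⌋ + ⌈ n /2⌉)    ≤⟨ +-monoʳ-≤ 2 (+-monoˡ-≤ ⌈ n /2⌉ (⌊n/2⌋≤⌈n/2⌉ n)) ⟩
    2 + (⌈ n /2⌉ + ⌈ n /2⌉)    ≡⟨ cong (λ k → 2 + (⌈ n /2⌉ + k)) (+-identityʳ ⌈ n /2⌉) ⟨
    2 + 2 * ⌈ n /2⌉            ≡⟨ *-suc 2 ⌈ n /2⌉ ⟨
    2 * suc ⌈ n /2⌉            ≤⟨ *-monoʳ-≤ 2 (go (suc ⌈ n /2⌉) _) ⟩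
    2 * 2 ^ ⌈log2⌉ (suc ⌈ n /2⌉) _  ∎

-- Answering queries from a decoded graph

answer : Graph n → Fin n → Fin n → Maybe (List (Fin n))
answer D s t with reach? D s t
... | yes π = just (proj₁ (pathList π))
... | no  _ = nothing

-- A path found in `D` is a path of `G`. If `D` has none, neither does `H`, which has the same
-- edges, and then neither does `G`, since `H` preserves the pair.
answer-correct : ∀ {G H D : Graph n} {P} → IsReachPreserver G P H → D ⊆G H → H ⊆G D →
  ∀ s t → (s , t) ∈ P → CorrectAnswer G s t (answer D s t)
answer-correct {D = D} (H⊆G , keeps) D⊆H H⊆D s t st∈P with reach? D s t
... | yes π    = isPath-mono (λ u v → H⊆G u v ∘ D⊆H u v) _ (proj₂ (pathList π))
  where
  isPath-mono : ∀ {G D : Graph n} → D ⊆G G → ∀ vs {s t} → IsPathList D s vs t → IsPathList G s vs t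
  isPath-mono D⊆G []       eq      = eq
  isPath-mono D⊆G (v ∷ vs) (e , p) = D⊆G _ v e , isPath-mono D⊆G vs p
... | no ¬path = λ reach → ¬path (reach-mono H⊆D (keeps s t st∈P reach))

module EdgeCodes (l-1 : ℕ) (n≤2^l : n ≤ 2 ^ suc l-1) where

  private l = suc l-1

  index : Fin n → Fin (length (words l))
  index u = inject≤ u (≤-trans n≤2^l (≤-reflexive (sym (length-words l))))

  vertexCode : Fin n → List Bool
  vertexCode u = lookup (words l) (index u)

  vertexCode-length : ∀ u → length (vertexCode u) ≡ l
  vertexCode-length u = All.lookup (words-length l) (∈-lookup (index u))

  vertexCode-injective : ∀ {u v} → vertexCode u ≡ vertexCode v → u ≡ v
  vertexCode-injective eq = Fin.inject≤-injective _ _ _ _ (lookup-injective (words-unique l) _ _ eq)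

  edgeCode : Fin n × Fin n → List Bool
  edgeCode (u , v) = vertexCode u ++ vertexCode v

  edgeCode-length : ∀ e → length (edgeCode e) ≡ l + l
  edgeCode-length (u , v) =
    trans (List.length-++ (vertexCode u)) (cong₂ _+_ (vertexCode-length u) (vertexCode-length v))

  edgeCode-injective : ∀ {e e′} → edgeCode e ≡ edgeCode e′ → e ≡ e′
  edgeCode-injective {u , v} {u′ , v′} eq = cong₂ _,_
    (vertexCode-injective (trans (sym (take-++ (vertexCode u) (vertexCode-length u)))
      (trans (cong (take l) eq) (take-++ (vertexCode u′) (vertexCode-length u′)))))
    (vertexCode-injective (trans (sym (drop-++ (vertexCode u) (vertexCode-length u)))
      (trans (cong (drop l) eq) (drop-++ (vertexCode u′) (vertexCode-length u′)))))

  open DecMembership (List.≡-dec Bool._≟_) using (_∈?_)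

  decode : ℕ → List Bool → Graph n
  decode r bits u v = does (edgeCode (u , v) ∈? chunks (l + l) r bits)

  decode-⊆ : ∀ r (H : Graph n) → decode r (concatMap edgeCode (edges H)) ⊆G H
  decode-⊆ r H u v e
    with ∈-map⁻ edgeCode (∈-chunks⁻ edgeCode edgeCode-length r (edges H) (does-true (_ ∈? _) e))
  ... | e′ , e′∈ , eq with refl ← edgeCode-injective eq = ∈-edges⁻ H e′∈

  decode-⊇ : ∀ r (H : Graph n) → edgeCount H ≤ r → H ⊆G decode r (concatMap edgeCode (edges H))
  decode-⊇ r H H≤r u v e = dec-true (_ ∈? _)
    (∈-chunks⁺ edgeCode edgeCode-length (edges H) (subst (_≤ r) (sym (length-edges H)) H≤r)
      (∈-map⁺ edgeCode (∈-edges⁺ H e)))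

  oracle-bits : ∀ r (H : Graph n) → edgeCount H ≤ r → length (concatMap edgeCode (edges H)) ≤ 2 * r * l
  oracle-bits r H H≤r = begin
    length (concatMap edgeCode (edges H))  ≤⟨ length-concatMap≤ edgeCode (edges H) (≤-reflexive ∘ edgeCode-length) ⟩
    length (edges H) * (l + l)             ≡⟨ cong (_* (l + l)) (length-edges H) ⟩
    edgeCount H * (l + l)                  ≤⟨ *-monoˡ-≤ (l + l) H≤r ⟩
    r * (l + l)                            ≡⟨ *-distribˡ-+ r l l ⟩
    r * l + r * l                          ≡⟨ *-distribʳ-+ l r r ⟨
    (r + r) * l                            ≡⟨ cong (λ k → (r + k) * l) (+-identityʳ r) ⟨
    2 * r * l                              ∎
    where open ≤-Reasoning

-- The upper bound, and both bounds combined

RP⇒PO : ∀ {n p r} l → n ≤ 2 ^ l → RPBound n p r → POBound n p (2 * r * l)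
-- Width zero leaves at most one vertex, so the empty path answers every query from the empty
-- string.
RP⇒PO {n} zero n≤1 _ P = (λ _ _ _ → just []) , λ G → [] , z≤n , λ s t _ →
  Fin.toℕ-injective (trans (n<1⇒n≡0 (<-≤-trans (Fin.toℕ<n s) n≤1))
                           (sym (n<1⇒n≡0 (<-≤-trans (Fin.toℕ<n t) n≤1))))
RP⇒PO {r = r} (suc l) n≤2^l preserver P = (λ bits → answer (decode r bits)) , λ G →
  let H , preserves , H≤r = preserver G P in
  concatMap edgeCode (edges H) , oracle-bits r H H≤r ,
  answer-correct preserves (decode-⊆ r H) (decode-⊇ r H H≤r)
  where open EdgeCodes l n≤2^l

mainTheorem7 : Σ ℕ λ c → Σ ℕ λ C →
    (n p r b : ℕ) → 1 ≤ n → 1 ≤ p → p ≤ n * n →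
    IsRP n p r → IsPO n p b →
    (r ≤ c * b) × (b ≤ C * r * ⌈log₂ n ⌉)
-- 36 counts the ordered pairs of the six colours, and 2 the vertex codes stored per edge.
-- Minimality of `r` and of `b` turns the transferred bounds into the inequalities.
mainTheorem7 = 36 , 2 , λ n p r b _ _ p≤n² (rp , rp-least) (po , po-least) →
  rp-least (36 * b) (PO⇒RP p≤n² po) ,
  po-least (2 * r * ⌈log₂ n ⌉) (RP⇒PO ⌈log₂ n ⌉ (n≤2^⌈log₂n⌉ n) rp)
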